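{- For any integers $k\ge 3$ and $t\ge 1$, there exists a colour-balanced $k$-edge-colouring of the complete graph $K_{2kt}$ with no colour-balanced perfect matching.
   Context: A $k$-edge-colouring is an arbitrary (not necessarily proper) map from the edge set to $[k]=\{1,\dots,k\}$; it is colour-balanced if all $k$ colour classes have the same size. A perfect matching is colour-balanced if each of the $k$ colours appears on equally many of its edges (here exactly $t$ each). -}

module Defs where

open import Data.Bool using (Bool; T; T?)
open import Data.Empty using (⊥)
open import Data.Fin using (Fin; zero; suc; _<_; _≟_)
open import Data.Fin.Properties using (<-irrelevant; suc-injective)
open import Data.List using (List; []; _++_; map; filter; length; allFin)
open import Data.List.Membership.Propositional using (_∈_)
open import Data.List.Membership.Propositional.Properties
  using (∈-map⁺; ∈-map⁻; ∈-++⁺ˡ; ∈-++⁺ʳ; ∈-allFin)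
open import Data.List.Relation.Unary.Unique.Propositional using (Unique; [])
open import Data.List.Relation.Unary.Unique.Propositional.Properties
  using (map⁺; ++⁺; allFin⁺)
open import Data.Nat using (ℕ; zero; suc; s≤s; z≤n)
open import Data.Product using (_×_; _,_; ∃!)
open import Data.Sum using (_⊎_)
open import Function using (_∘_)
open import Relation.Binary.PropositionalEquality using (_≡_; refl; cong)

-- An edge of the complete graph on the vertex set Fin n.  An unordered pair of
-- distinct vertices is listed with its smaller element first; since _<_ is
-- proof-irrelevant, each pair gives exactly one edge up to _≡_.
record Edge (n : ℕ) : Set where
  constructor edge
  field
    low high : Fin n
    low<high : low < high

open Edge public

_∈ₑ_ : ∀ {n} → Fin n → Edge n → Set
v ∈ₑ e = v ≡ low e ⊎ v ≡ high e

edge₀ : ∀ {n} → Fin n → Edge (suc n)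
edge₀ j = edge zero (suc j) (s≤s z≤n)

shift : ∀ {n} → Edge n → Edge (suc n)
shift (edge i j i<j) = edge (suc i) (suc j) (s≤s i<j)

-- All edges, each exactly once (see ∈-edges and edges-unique): first those
-- at vertex zero, then those of the complete graph on the other vertices.
edges : ∀ n → List (Edge n)
edges zero    = []
edges (suc n) = map edge₀ (allFin n) ++ map shift (edges n)

∈-edges : ∀ {n} (e : Edge n) → e ∈ edges n
∈-edges {suc n} (edge zero (suc j) (s≤s z≤n)) =
  ∈-++⁺ˡ (∈-map⁺ edge₀ (∈-allFin j))
∈-edges {suc n} (edge (suc i) (suc j) (s≤s i<j)) =
  ∈-++⁺ʳ (map edge₀ (allFin n)) (∈-map⁺ shift (∈-edges (edge i j i<j)))

edges-unique : ∀ n → Unique (edges n)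
edges-unique zero    = []
edges-unique (suc n) =
  ++⁺ (map⁺ edge₀-injective (allFin⁺ n))
      (map⁺ shift-injective (edges-unique n))
      disjoint
  where
  edge₀-injective : ∀ {i j : Fin n} → edge₀ i ≡ edge₀ j → i ≡ j
  edge₀-injective eq = suc-injective (cong high eq)

  shift-injective : ∀ {e f : Edge n} → shift e ≡ shift f → e ≡ f
  shift-injective {edge i j p} {edge k l q} eq
    with refl ← suc-injective (cong low eq)
       | refl ← suc-injective (cong high eq)
    = cong (edge i j) (<-irrelevant p q)

  disjoint : ∀ {e} → e ∈ map edge₀ (allFin n) × e ∈ map shift (edges n) → ⊥
  disjoint (p , q)
    with _ , _ , refl ← ∈-map⁻ edge₀ p
    with _ , _ , ()   ← ∈-map⁻ shift q

EdgeColouring : ℕ → ℕ → Set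
EdgeColouring k n = Edge n → Fin k

colourCount : ∀ {k n} → EdgeColouring k n → Fin k → List (Edge n) → ℕ
colourCount χ c es = length (filter (λ e → χ e ≟ c) es)

-- All colours occur equally often among the edges listed.  Used only for
-- lists without repetitions, which stand for sets of edges.
EquallyColoured : ∀ {k n} → EdgeColouring k n → List (Edge n) → Set
EquallyColoured χ es = ∀ c d → colourCount χ c es ≡ colourCount χ d es

ColourBalanced : ∀ {k n} → EdgeColouring k n → Set
ColourBalanced {n = n} χ = EquallyColoured χ (edges n)

-- Sets of edges, given by their characteristic functions.
EdgeSet : ℕ → Set
EdgeSet n = Edge n → Bool

members : ∀ {n} → EdgeSet n → List (Edge n)
members {n} M = filter (T? ∘ M) (edges n)

PerfectMatching : ∀ {n} → EdgeSet n → Set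
PerfectMatching {n} M = ∀ (v : Fin n) → ∃! _≡_ (λ e → T (M e) × v ∈ₑ e)

ColourBalancedMatching : ∀ {k n} → EdgeColouring k n → EdgeSet n → Set
ColourBalancedMatching χ M = PerfectMatching M × EquallyColoured χ (members M)

{-# OPTIONS --safe #-}

-- Single out vertex zero and label the other N = 2kt - 1 vertices 0, ..., N - 1.
-- An edge {u, v} avoiding vertex zero gets the colour u + v modulo k.  If a
-- perfect matching is colour-balanced and matches vertex zero with j, then
-- comparing the sum of its colours with the sum of all labels determines the
-- colour of the edge {zero, j} modulo k.  So there is no colour-balanced perfect
-- matching as soon as each edge at vertex zero avoids that one colour.  Each
-- colour c is still needed on a certain number of the edges at vertex zero;
-- this demand plus the number of edges at which c is forbidden is at most N, so
-- by Hall's theorem the demands can be met.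

module Submission where

open import Defs
import Algebra.Properties.Semiring.Sum as Sum
open import Data.Bool using (true; false; T; T?; if_then_else_)
open import Data.Fin using (Fin; zero; suc; toℕ; _≟_)
open import Data.Fin.Properties using (<-irrelevant; any?; toℕ<n; toℕ-injective; toℕ-fromℕ<; suc-injective; <⇒≢)
open import Data.List using ([]; _∷_; _++_; filter; length; map; allFin; tabulate)
open import Data.List.Properties using (map-++; map-∘; map-tabulate; filter-all)
import Data.List.Relation.Unary.All as All
open import Data.Nat
  using (ℕ; zero; suc; _+_; _*_; _∸_; pred; _≤_; _<_; _%_; z≤n; s≤s; NonZero)
  renaming (_≟_ to _≟ℕ_; _<?_ to _<?ℕ_)
open import Data.Nat.DivMod
import Data.Nat.ListAction as List using (sum)
import Data.Nat.ListAction.Properties as List using (sum-++)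
open import Data.Nat.Properties hiding (_≟_; _<?_; <-irrelevant; suc-injective; <⇒≢)
open import Data.Nat.Tactic.RingSolver using (solve-∀)
open import Data.Product using (_×_; _,_; ∃; Σ-syntax; proj₁; proj₂)
open import Data.Sum using (inj₁; inj₂)
open import Function using (_∘_; id)
open import Relation.Binary.PropositionalEquality
open import Relation.Nullary using (¬_; Dec; yes; no; does; contradiction; ¬?; _×-dec_)
open Sum +-*-semiring
  using (sum; sum-syntax; sum-cong-≗; ∑-distrib-+; ∑-comm; *-distribˡ-sum)

private variable
  n k : ℕ

-- Indicators, finite sums and colour counts

⟦_⟧ : ∀ {P : Set} → Dec P → ℕ
⟦ P? ⟧ = if does P? then 1 else 0

⟦⟧-yes : ∀ {P : Set} (P? : Dec P) → P → ⟦ P? ⟧ ≡ 1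
⟦⟧-yes (yes _) p = refl
⟦⟧-yes (no ¬p) p = contradiction p ¬p

⟦⟧-no : ∀ {P : Set} (P? : Dec P) → ¬ P → ⟦ P? ⟧ ≡ 0
⟦⟧-no (yes p) ¬p = contradiction p ¬p
⟦⟧-no (no _)  ¬p = refl

⟦⟧≤1 : ∀ {P : Set} (P? : Dec P) → ⟦ P? ⟧ ≤ 1
⟦⟧≤1 (yes _) = s≤s z≤n
⟦⟧≤1 (no _)  = z≤n

sum-const : ∀ n c → ∑[ i < n ] c ≡ n * c
sum-const zero    c = refl
sum-const (suc n) c = cong (c +_) (sum-const n c)

sum-mono : {f g : Fin n → ℕ} → (∀ i → f i ≤ g i) → sum f ≤ sum g
sum-mono {zero}  f≤g = z≤n
sum-mono {suc n} f≤g = +-mono-≤ (f≤g zero) (sum-mono (f≤g ∘ suc))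

sum-zero : {f : Fin n → ℕ} → (∀ i → f i ≡ 0) → sum f ≡ 0
sum-zero {n} f≡0 = trans (sum-cong-≗ f≡0) (trans (sum-const n 0) (*-zeroʳ n))

sum-single : (f : Fin n → ℕ) (i : Fin n) → (∀ j → j ≢ i → f j ≡ 0) → sum f ≡ f i
sum-single f zero f≡0 =
  trans (cong (f zero +_) (sum-zero λ j → f≡0 (suc j) λ ())) (+-identityʳ _)
sum-single f (suc i) f≡0 =
  cong₂ _+_ (f≡0 zero λ ())
    (sum-single (f ∘ suc) i λ j j≢i → f≡0 (suc j) (j≢i ∘ suc-injective))

sum-⟦≟⟧ : (w : Fin n → ℕ) (i : Fin n) → ∑[ j < n ] (w j * ⟦ i ≟ j ⟧) ≡ w i
sum-⟦≟⟧ w i = trans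
  (sum-single _ i λ j j≢i →
    trans (cong (w j *_) (⟦⟧-no (i ≟ j) (j≢i ∘ sym))) (*-zeroʳ (w j)))
  (trans (cong (w i *_) (⟦⟧-yes (i ≟ i) refl)) (*-identityʳ (w i)))

term≤sum : (f : Fin n → ℕ) (i : Fin n) → f i ≤ sum f
term≤sum f zero    = m≤m+n _ _
term≤sum f (suc i) = ≤-trans (term≤sum (f ∘ suc) i) (m≤n+m _ _)

terms≤sum : (f : Fin n → ℕ) {i j : Fin n} → i ≢ j → f i + f j ≤ sum f
terms≤sum f {zero}  {zero}  i≢j = contradiction refl i≢j
terms≤sum f {zero}  {suc j} i≢j = +-monoʳ-≤ (f zero) (term≤sum (f ∘ suc) j)
terms≤sum f {suc i} {zero}  i≢j = subst (_≤ sum f) (+-comm (f zero) _)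
  (+-monoʳ-≤ (f zero) (term≤sum (f ∘ suc) i))
terms≤sum f {suc i} {suc j} i≢j =
  ≤-trans (terms≤sum (f ∘ suc) (i≢j ∘ cong suc)) (m≤n+m _ _)

count : (Fin n → Fin k) → Fin k → ℕ
count {n} φ c = ∑[ v < n ] ⟦ φ v ≟ c ⟧

sum-weights : (w : Fin k → ℕ) (φ : Fin n → Fin k) →
              ∑[ c < k ] (w c * count φ c) ≡ ∑[ v < n ] w (φ v)
sum-weights {k} {n} w φ = begin
  ∑[ c < k ] (w c * count φ c)               ≡⟨ sum-cong-≗ (λ c → *-distribˡ-sum (w c) (λ v → ⟦ φ v ≟ c ⟧)) ⟩
  ∑[ c < k ] ∑[ v < n ] (w c * ⟦ φ v ≟ c ⟧)  ≡⟨ ∑-comm (λ c v → w c * ⟦ φ v ≟ c ⟧) ⟩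
  ∑[ v < n ] ∑[ c < k ] (w c * ⟦ φ v ≟ c ⟧)  ≡⟨ sum-cong-≗ (λ v → sum-⟦≟⟧ w (φ v)) ⟩
  ∑[ v < n ] w (φ v)                         ∎
  where open ≡-Reasoning

sum-count : (φ : Fin n → Fin k) → sum (count φ) ≡ n
sum-count {n} φ = begin
  sum (count φ)                  ≡⟨ sum-cong-≗ (λ c → sym (*-identityˡ (count φ c))) ⟩
  sum (λ c → 1 * count φ c)      ≡⟨ sum-weights (λ _ → 1) φ ⟩
  ∑[ v < n ] 1                   ≡⟨ sum-const n 1 ⟩
  n * 1                          ≡⟨ *-identityʳ n ⟩
  n                              ∎
  where open ≡-Reasoning

-- Assignments with one forbidden colour per element and prescribed multiplicities

Avoiding : (φ : Fin n → Fin k) (d : Fin k → ℕ) → Set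
Avoiding {n} {k} φ d =
  Σ[ α ∈ (Fin n → Fin k) ] (∀ v → α v ≢ φ v) × (∀ c → count α c ≡ d c)

-- It suffices to colour one element so that Hall's condition survives.  At
-- most one colour other than the forbidden one can be tight, because the
-- left-hand sides of Hall's condition add up to n + n.
avoiding : (φ : Fin n → Fin k) (d : Fin k → ℕ) → sum d ≡ n →
           (∀ c → d c + count φ c ≤ n) → Avoiding φ d
avoiding {zero} φ d Σd≡0 hall =
  (λ ()) , (λ ()) , λ c → sym (n≤0⇒n≡0 (≤-trans (term≤sum d c) (≤-reflexive Σd≡0)))
avoiding {suc n} {k} φ d Σd≡n hall = choose
  where
  i = φ zero
  φ′ = φ ∘ suc

  -- `j` is a candidate colour for the element `zero`; `d′` is the demand then left to the other
  -- elements.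
  module _ (j : Fin k) (dj>0 : 0 < d j) where
    d′ : Fin k → ℕ
    d′ c = d c ∸ ⟦ j ≟ c ⟧

    d′-split : ∀ c → ⟦ j ≟ c ⟧ + d′ c ≡ d c
    d′-split c with j ≟ c
    ... | yes refl = m+[n∸m]≡n dj>0
    ... | no  _    = refl

    Σd′≡n : sum d′ ≡ n
    Σd′≡n = +-cancelˡ-≡ 1 _ _ (begin
      1 + sum d′                            ≡⟨ cong (_+ sum d′) (sym (sum-⟦≟⟧ (λ _ → 1) j)) ⟩
      ∑[ c < k ] (1 * ⟦ j ≟ c ⟧) + sum d′   ≡⟨ sym (∑-distrib-+ (λ c → 1 * ⟦ j ≟ c ⟧) d′) ⟩
      ∑[ c < k ] (1 * ⟦ j ≟ c ⟧ + d′ c)     ≡⟨ sum-cong-≗ (λ c → cong (_+ d′ c) (*-identityˡ ⟦ j ≟ c ⟧)) ⟩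
      ∑[ c < k ] (⟦ j ≟ c ⟧ + d′ c)         ≡⟨ sum-cong-≗ d′-split ⟩
      sum d                                 ≡⟨ Σd≡n ⟩
      suc n                                 ∎)
      where open ≡-Reasoning

    extend : j ≢ i → (∀ c → d′ c + count φ′ c ≤ n) → Avoiding φ d
    extend j≢i hall′ with α , α≢φ′ , #α ← avoiding φ′ d′ Σd′≡n hall′ =
      α⁺ , (λ { zero → j≢i ; (suc v) → α≢φ′ v }) ,
      λ c → trans (cong (⟦ j ≟ c ⟧ +_) (#α c)) (d′-split c)
      where
      α⁺ : Fin (suc n) → Fin k
      α⁺ zero    = j
      α⁺ (suc v) = α v

    Σ[d′+#φ′]≡n+n : ∑[ c < k ] (d′ c + count φ′ c) ≡ n + n
    Σ[d′+#φ′]≡n+n = trans (∑-distrib-+ d′ (count φ′)) (cong₂ _+_ Σd′≡n (sum-count φ′))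

    -- The demand for `j` drops by one, while its forbidden count keeps its value because `zero`
    -- forbids `i` and not `j`.
    still-tight : j ≢ i → d j + count φ j ≡ suc n → d′ j + count φ′ j ≡ n
    still-tight j≢i tight = +-cancelˡ-≡ 1 _ _ (begin
      1 + (d′ j + count φ′ j)            ≡⟨ cong (λ x → x + (d′ j + count φ′ j)) (sym (⟦⟧-yes (j ≟ j) refl)) ⟩
      ⟦ j ≟ j ⟧ + (d′ j + count φ′ j)    ≡⟨ sym (+-assoc ⟦ j ≟ j ⟧ _ _) ⟩
      ⟦ j ≟ j ⟧ + d′ j + count φ′ j      ≡⟨ cong (_+ count φ′ j) (d′-split j) ⟩
      d j + count φ′ j                   ≡⟨ cong (λ x → d j + (x + count φ′ j)) (sym (⟦⟧-no (i ≟ j) (j≢i ∘ sym))) ⟩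
      d j + count φ j                    ≡⟨ tight ⟩
      suc n                              ∎)
      where open ≡-Reasoning

    -- The new left-hand sides add up to `n + n` and `j` alone takes `n`, so at most `n` remains for
    -- any other colour.
    hall-tight : j ≢ i → d j + count φ j ≡ suc n → ∀ c → d′ c + count φ′ c ≤ n
    hall-tight j≢i tight c with c ≟ j
    ... | yes refl = ≤-reflexive (still-tight j≢i tight)
    ... | no c≢j = +-cancelʳ-≤ n _ n (begin
      d′ c + count φ′ c + n                    ≡⟨ cong (d′ c + count φ′ c +_) (sym (still-tight j≢i tight)) ⟩
      d′ c + count φ′ c + (d′ j + count φ′ j)  ≤⟨ terms≤sum (λ c → d′ c + count φ′ c) c≢j ⟩
      ∑[ c < k ] (d′ c + count φ′ c)           ≡⟨ Σ[d′+#φ′]≡n+n ⟩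
      n + n                                    ∎)
      where open ≤-Reasoning

    -- Colour `i` loses its forbidden occurrence at `zero`; every other colour had room to spare, so
    -- its bound may drop by one.
    hall-slack : (∀ c → c ≢ i → d c + count φ c ≢ suc n) → ∀ c → d′ c + count φ′ c ≤ n
    hall-slack slack c with c ≟ i
    ... | yes refl = ≤-pred (begin
      suc (d′ c + count φ′ c)          ≡⟨ sym (+-suc (d′ c) _) ⟩
      d′ c + (1 + count φ′ c)          ≡⟨ cong (λ x → d′ c + (x + count φ′ c)) (sym (⟦⟧-yes (i ≟ i) refl)) ⟩
      d′ c + count φ c                 ≤⟨ +-monoˡ-≤ (count φ c) (m∸n≤m (d c) ⟦ j ≟ c ⟧) ⟩
      d c + count φ c                  ≤⟨ hall c ⟩
      suc n                            ∎)
      where open ≤-Reasoning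
    ... | no c≢i = ≤-trans
      (+-mono-≤ (m∸n≤m (d c) ⟦ j ≟ c ⟧) (m≤n+m (count φ′ c) ⟦ i ≟ c ⟧))
      (≤-pred (≤∧≢⇒< (hall c) (slack c c≢i)))

  choose : Avoiding φ d
  choose with any? (λ c → ¬? (c ≟ i) ×-dec (d c + count φ c ≟ℕ suc n))
  -- A tight colour stays within the smaller bound only if `zero` takes it.
  ... | yes (j , j≢i , tight) = extend j dj>0 j≢i (hall-tight j dj>0 j≢i tight)
    where
    -- Without demand for `j`, tightness would make `j` forbidden at all `suc n` elements, but
    -- `zero` forbids `i`.
    dj>0 : 0 < d j
    dj>0 = n≢0⇒n>0 λ dj≡0 → contradiction (begin
      suc n             ≡⟨ sym tight ⟩
      d j + count φ j   ≡⟨ cong₂ (λ x y → x + (y + count φ′ j)) dj≡0 (⟦⟧-no (i ≟ j) (j≢i ∘ sym)) ⟩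
      count φ′ j        ≤⟨ sum-mono (λ v → ⟦⟧≤1 (φ′ v ≟ j)) ⟩
      ∑[ v < n ] 1      ≡⟨ trans (sum-const n 1) (*-identityʳ n) ⟩
      n                 ∎) 1+n≰n
      where open ≤-Reasoning
  ... | no ¬tight with any? (λ c → ¬? (c ≟ i) ×-dec (0 <?ℕ d c))
  ...   | yes (j , j≢i , dj>0) =
    extend j dj>0 j≢i (hall-slack j dj>0 λ c c≢i tight → ¬tight (c , c≢i , tight))
  -- All demand would fall on `i`, which `zero` cannot take: `d i` would be `suc n` with `count φ i`
  -- at least 1, against `hall i`.
  ...   | no ¬demand = contradiction (begin
      suc (suc n)                    ≡⟨ cong suc (sym Σd≡n) ⟩
      suc (sum d)                    ≡⟨ cong suc (sum-single d i λ c c≢i →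
                                          n≤0⇒n≡0 (≮⇒≥ λ dc>0 → ¬demand (c , c≢i , dc>0))) ⟩
      suc (d i)                      ≤⟨ s≤s (m≤m+n (d i) (count φ′ i)) ⟩
      suc (d i + count φ′ i)         ≡⟨ sym (+-suc (d i) _) ⟩
      d i + (1 + count φ′ i)         ≡⟨ cong (λ x → d i + (x + count φ′ i)) (sym (⟦⟧-yes (i ≟ i) refl)) ⟩
      d i + count φ i                ≤⟨ hall i ⟩
      suc n                          ∎) 1+n≰n
    where open ≤-Reasoning

-- Sums over the edges of a complete graph

-- The recursion follows that of `edges`, so the edges at vertex zero split off definitionally.
∑ₑ : (Edge n → ℕ) → ℕ
∑ₑ {zero}  h = 0
∑ₑ {suc n} h = sum (h ∘ edge₀) + ∑ₑ (h ∘ shift)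

∑ₑ-cong : {g h : Edge n → ℕ} → (∀ e → g e ≡ h e) → ∑ₑ g ≡ ∑ₑ h
∑ₑ-cong {zero}  g≗h = refl
∑ₑ-cong {suc n} g≗h = cong₂ _+_ (sum-cong-≗ (g≗h ∘ edge₀)) (∑ₑ-cong (g≗h ∘ shift))

*-distribˡ-∑ₑ : ∀ x (h : Edge n → ℕ) → x * ∑ₑ h ≡ ∑ₑ (λ e → x * h e)
*-distribˡ-∑ₑ {zero}  x h = *-zeroʳ x
*-distribˡ-∑ₑ {suc n} x h = trans (*-distribˡ-+ x (sum (h ∘ edge₀)) _)
  (cong₂ _+_ (*-distribˡ-sum x (h ∘ edge₀)) (*-distribˡ-∑ₑ x (h ∘ shift)))

∑-∑ₑ-comm : (f : Fin k → Edge n → ℕ) →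
            ∑[ i < k ] ∑ₑ (f i) ≡ ∑ₑ (λ e → ∑[ i < k ] f i e)
∑-∑ₑ-comm {k} {zero}  f = sum-zero {k} λ _ → refl
∑-∑ₑ-comm {k} {suc n} f = trans (∑-distrib-+ (λ i → sum (f i ∘ edge₀)) _)
  (cong₂ _+_ (∑-comm (λ i → f i ∘ edge₀)) (∑-∑ₑ-comm (λ i → f i ∘ shift)))

shift-injective : {e f : Edge n} → shift e ≡ shift f → e ≡ f
shift-injective {e = edge i j p} {edge k l q} eq
  with refl ← suc-injective (cong low eq) | refl ← suc-injective (cong high eq)
  = cong (edge i j) (<-irrelevant p q)

∑ₑ-zero : {h : Edge n → ℕ} → (∀ e → h e ≡ 0) → ∑ₑ h ≡ 0
∑ₑ-zero {zero}  h≡0 = refl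
∑ₑ-zero {suc n} h≡0 = cong₂ _+_ (sum-zero (h≡0 ∘ edge₀)) (∑ₑ-zero (h≡0 ∘ shift))

∑ₑ-single : (h : Edge n → ℕ) (e : Edge n) → (∀ f → f ≢ e → h f ≡ 0) → ∑ₑ h ≡ h e
∑ₑ-single {suc n} h (edge zero (suc j) (s≤s z≤n)) h≡0 = trans
  (cong₂ _+_
    (sum-single (h ∘ edge₀) j λ i i≢j → h≡0 (edge₀ i) (i≢j ∘ suc-injective ∘ cong high))
    (∑ₑ-zero λ f → h≡0 (shift f) λ ()))
  (+-identityʳ _)
∑ₑ-single {suc n} h (edge (suc i) (suc j) (s≤s i<j)) h≡0 = cong₂ _+_
  (sum-zero λ l → h≡0 (edge₀ l) λ ())
  (∑ₑ-single (h ∘ shift) (edge i j i<j) λ f f≢e → h≡0 (shift f) (f≢e ∘ shift-injective))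

-- Every edge comes from two ordered pairs, and the diagonal is left over. The induction peels off
-- the row and the column of zero, which agree by symmetry.
∑-symmetric : (f : Fin n → Fin n → ℕ) → (∀ u v → f u v ≡ f v u) →
              ∑[ u < n ] ∑[ v < n ] f u v ≡
              2 * ∑ₑ (λ e → f (low e) (high e)) + ∑[ u < n ] f u u
∑-symmetric {zero}  f f-sym = refl
∑-symmetric {suc n} f f-sym = begin
  f₀₀ + a + ∑[ u < n ] (f (suc u) zero + ∑[ v < n ] f (suc u) (suc v))
    ≡⟨ cong (f₀₀ + a +_) (∑-distrib-+ (λ u → f (suc u) zero) _) ⟩
  f₀₀ + a + (∑[ u < n ] f (suc u) zero + ∑[ u < n ] ∑[ v < n ] f (suc u) (suc v))
    ≡⟨ cong₂ (λ x y → f₀₀ + a + (x + y))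
         (sum-cong-≗ λ u → f-sym (suc u) zero)
         (∑-symmetric (λ u v → f (suc u) (suc v)) λ u v → f-sym (suc u) (suc v)) ⟩
  f₀₀ + a + (a + (2 * b + c))
    ≡⟨ regroup f₀₀ a b c ⟩
  2 * (a + b) + (f₀₀ + c) ∎
  where
  open ≡-Reasoning
  f₀₀ = f zero zero
  a = ∑[ v < n ] f zero (suc v)
  b = ∑ₑ (λ e → f (suc (low e)) (suc (high e)))
  c = ∑[ u < n ] f (suc u) (suc u)
  regroup : ∀ z a b c → z + a + (a + (2 * b + c)) ≡ 2 * (a + b) + (z + c)
  regroup = solve-∀

-- Colour counts and perfect matchings as edge sums

sum-edges : (h : Edge n → ℕ) → List.sum (map h (edges n)) ≡ ∑ₑ h
sum-edges {zero}  h = refl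
sum-edges {suc n} h = begin
  List.sum (map h (map edge₀ (allFin n) ++ map shift (edges n)))
    ≡⟨ cong List.sum (map-++ h (map edge₀ (allFin n)) _) ⟩
  List.sum (map h (map edge₀ (allFin n)) ++ map h (map shift (edges n)))
    ≡⟨ List.sum-++ (map h (map edge₀ (allFin n))) _ ⟩
  List.sum (map h (map edge₀ (allFin n))) + List.sum (map h (map shift (edges n)))
    ≡⟨ cong₂ (λ x y → List.sum x + List.sum y)
         (trans (sym (map-∘ (allFin n))) (map-tabulate id (h ∘ edge₀)))
         (sym (map-∘ (edges n))) ⟩
  List.sum (tabulate (h ∘ edge₀)) + List.sum (map (h ∘ shift) (edges n))
    ≡⟨ cong₂ _+_ (sum-tabulate (h ∘ edge₀)) (sum-edges (h ∘ shift)) ⟩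
  ∑ₑ h ∎
  where
  open ≡-Reasoning
  sum-tabulate : ∀ {m} (f : Fin m → ℕ) → List.sum (tabulate f) ≡ sum f
  sum-tabulate {zero}  f = refl
  sum-tabulate {suc m} f = cong (f zero +_) (sum-tabulate (f ∘ suc))

length-filter-filter :
  ∀ {A : Set} {P Q : A → Set} (P? : ∀ x → Dec (P x)) (Q? : ∀ x → Dec (Q x)) xs →
  length (filter P? (filter Q? xs)) ≡ List.sum (map (λ x → ⟦ Q? x ⟧ * ⟦ P? x ⟧) xs)
length-filter-filter P? Q? [] = refl
length-filter-filter P? Q? (x ∷ xs) with ih ← length-filter-filter P? Q? xs | does (Q? x)
... | false = ih
... | true with does (P? x)
...   | false = ih
...   | true  = cong suc ih

colourCount-members : (χ : EdgeColouring k n) (M : EdgeSet n) (c : Fin k) →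
  colourCount χ c (members M) ≡ ∑ₑ (λ e → ⟦ T? (M e) ⟧ * ⟦ χ e ≟ c ⟧)
colourCount-members {n = n} χ M c = trans
  (length-filter-filter (λ e → χ e ≟ c) (T? ∘ M) (edges n)) (sum-edges {n} _)

colourCount-edges : (χ : EdgeColouring k n) (c : Fin k) →
  colourCount χ c (edges n) ≡ ∑ₑ (λ e → ⟦ χ e ≟ c ⟧)
colourCount-edges {n = n} χ c = begin
  colourCount χ c (edges n)
    -- The full edge list is the member list of the set of all edges, so the formula for edge sets
    -- applies.
    ≡⟨ cong (colourCount χ c) (sym (filter-all (T? ∘ λ _ → true) (All.universal _ (edges n)))) ⟩
  colourCount χ c (members λ _ → true)
    ≡⟨ colourCount-members χ (λ _ → true) c ⟩
  ∑ₑ (λ e → 1 * ⟦ χ e ≟ c ⟧)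
    ≡⟨ ∑ₑ-cong (λ e → *-identityˡ ⟦ χ e ≟ c ⟧) ⟩
  ∑ₑ (λ e → ⟦ χ e ≟ c ⟧) ∎
  where open ≡-Reasoning

-- After exchanging the sums, each edge meets only its own colour. With `x` the indicator of a
-- matching, weight 1 counts its edges and weight `toℕ` adds up their colours.
∑ₑ-weights : (w : Fin k → ℕ) (x : Edge n → ℕ) (χ : EdgeColouring k n) →
  ∑[ c < k ] (w c * ∑ₑ (λ e → x e * ⟦ χ e ≟ c ⟧)) ≡ ∑ₑ (λ e → x e * w (χ e))
∑ₑ-weights {k} w x χ = begin
  ∑[ c < k ] (w c * ∑ₑ (λ e → x e * ⟦ χ e ≟ c ⟧))
    ≡⟨ sum-cong-≗ (λ c → trans (*-distribˡ-∑ₑ (w c) (λ e → x e * ⟦ χ e ≟ c ⟧))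
         (∑ₑ-cong λ e → swap (w c) (x e) ⟦ χ e ≟ c ⟧)) ⟩
  ∑[ c < k ] ∑ₑ (λ e → x e * (w c * ⟦ χ e ≟ c ⟧))
    ≡⟨ ∑-∑ₑ-comm (λ c e → x e * (w c * ⟦ χ e ≟ c ⟧)) ⟩
  ∑ₑ (λ e → ∑[ c < k ] (x e * (w c * ⟦ χ e ≟ c ⟧)))
    ≡⟨ ∑ₑ-cong (λ e → trans (sym (*-distribˡ-sum (x e) (λ c → w c * ⟦ χ e ≟ c ⟧)))
         (cong (x e *_) (sum-⟦≟⟧ w (χ e)))) ⟩
  ∑ₑ (λ e → x e * w (χ e)) ∎
  where
  open ≡-Reasoning
  swap : ∀ a b c → a * (b * c) ≡ b * (a * c)
  swap = solve-∀

-- Double counting: every vertex lies on exactly one edge of `M`, so `g v` may be multiplied by the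
-- degree of `v` before the sums are exchanged.
handshake : {M : EdgeSet n} → PerfectMatching M → (g : Fin n → ℕ) →
            ∑ₑ (λ e → ⟦ T? (M e) ⟧ * (g (low e) + g (high e))) ≡ sum g
handshake {n} {M} perfect g = sym (begin
  sum g
    ≡⟨ sum-cong-≗ (λ v → sym (trans (cong (g v *_) (degree v)) (*-identityʳ (g v)))) ⟩
  ∑[ v < n ] (g v * ∑ₑ (λ e → m e * inc v e))
    ≡⟨ sum-cong-≗ (λ v → trans (*-distribˡ-∑ₑ (g v) (λ e → m e * inc v e))
         (∑ₑ-cong λ e → expand (g v) (m e) ⟦ low e ≟ v ⟧ ⟦ high e ≟ v ⟧)) ⟩
  ∑[ v < n ] ∑ₑ (λ e → m e * (g v * ⟦ low e ≟ v ⟧ + g v * ⟦ high e ≟ v ⟧))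
    ≡⟨ ∑-∑ₑ-comm (λ v e → m e * (g v * ⟦ low e ≟ v ⟧ + g v * ⟦ high e ≟ v ⟧)) ⟩
  ∑ₑ (λ e → ∑[ v < n ] (m e * (g v * ⟦ low e ≟ v ⟧ + g v * ⟦ high e ≟ v ⟧)))
    ≡⟨ ∑ₑ-cong (λ e → trans
         (sym (*-distribˡ-sum (m e) (λ v → g v * ⟦ low e ≟ v ⟧ + g v * ⟦ high e ≟ v ⟧)))
         (cong (m e *_) (trans (∑-distrib-+ (λ v → g v * ⟦ low e ≟ v ⟧) _)
           (cong₂ _+_ (sum-⟦≟⟧ g (low e)) (sum-⟦≟⟧ g (high e)))))) ⟩
  ∑ₑ (λ e → m e * (g (low e) + g (high e))) ∎)
  where
  open ≡-Reasoning
  m : Edge n → ℕ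
  m e = ⟦ T? (M e) ⟧
  inc : Fin n → Edge n → ℕ
  inc v e = ⟦ low e ≟ v ⟧ + ⟦ high e ≟ v ⟧

  expand : ∀ g m a b → g * (m * (a + b)) ≡ m * (g * a + g * b)
  expand = solve-∀

  inc-∈ : ∀ {v} e → v ∈ₑ e → inc v e ≡ 1
  inc-∈ e (inj₁ refl) = cong₂ _+_ (⟦⟧-yes (low e ≟ low e) refl)
    (⟦⟧-no (high e ≟ low e) (<⇒≢ (low<high e) ∘ sym))
  inc-∈ e (inj₂ refl) = cong₂ _+_ (⟦⟧-no (low e ≟ high e) (<⇒≢ (low<high e)))
    (⟦⟧-yes (high e ≟ high e) refl)

  inc-∉ : ∀ {v} e → ¬ v ∈ₑ e → inc v e ≡ 0
  inc-∉ {v} e v∉e = cong₂ _+_ (⟦⟧-no (low e ≟ v) (v∉e ∘ inj₁ ∘ sym))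
    (⟦⟧-no (high e ≟ v) (v∉e ∘ inj₂ ∘ sym))

  degree : ∀ v → ∑ₑ (λ e → m e * inc v e) ≡ 1
  degree v with e , (e∈M , v∈e) , unique ← perfect v =
    trans (∑ₑ-single _ e off) (cong₂ _*_ (⟦⟧-yes (T? (M e)) e∈M) (inc-∈ e v∈e))
    where
    off : ∀ f → f ≢ e → m f * inc v f ≡ 0
    off f f≢e with T? (M f)
    ... | no  f∉M = cong (_* inc v f) (⟦⟧-no (T? (M f)) f∉M)
    ... | yes f∈M = trans
      (cong (m f *_) (inc-∉ f λ v∈f → f≢e (sym (unique (f∈M , v∈f)))))
      (*-zeroʳ (m f))

-- Residues modulo `k` in intervals of integers

module Residues (k : ℕ) .{{_ : NonZero k}} where

  toℕ-mod : ∀ x → toℕ (x mod k) ≡ x % k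
  toℕ-mod x = toℕ-fromℕ< (m%n<n x k)

  mod-cong : ∀ {x y} → x % k ≡ y % k → x mod k ≡ y mod k
  mod-cong {x} {y} x≈y = toℕ-injective (trans (toℕ-mod x) (trans x≈y (sym (toℕ-mod y))))

  toℕ[i]-mod : ∀ (i : Fin k) → toℕ i mod k ≡ i
  toℕ[i]-mod i = toℕ-injective (trans (toℕ-mod (toℕ i)) (m<n⇒m%n≡m (toℕ<n i)))

  +-cong-% : ∀ {x x′ y y′} → x % k ≡ x′ % k → y % k ≡ y′ % k → (x + y) % k ≡ (x′ + y′) % k
  +-cong-% {x} {x′} {y} {y′} p q = trans (%-distribˡ-+ x y k)
    (trans (cong₂ (λ a b → (a + b) % k) p q) (sym (%-distribˡ-+ x′ y′ k)))

  sum-cong-% : {g h : Fin n → ℕ} → (∀ i → g i % k ≡ h i % k) → sum g % k ≡ sum h % k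
  sum-cong-% {zero}  g≈h = refl
  sum-cong-% {suc n} g≈h = +-cong-% (g≈h zero) (sum-cong-% (g≈h ∘ suc))

  ∑ₑ-cong-% : {g h : Edge n → ℕ} → (∀ e → g e % k ≡ h e % k) → ∑ₑ g % k ≡ ∑ₑ h % k
  ∑ₑ-cong-% {zero}  g≈h = refl
  ∑ₑ-cong-% {suc n} g≈h = +-cong-% (sum-cong-% (g≈h ∘ edge₀)) (∑ₑ-cong-% (g≈h ∘ shift))

  -- This concerns the interval of `n` consecutive integers starting at `a`; a variable start allows
  -- intervals to be concatenated and moved.
  residueCount : ℕ → ℕ → Fin k → ℕ
  residueCount n a = count {n} (λ v → (toℕ v + a) mod k)

  residueCount-+ : ∀ m n a s →
    residueCount (m + n) a s ≡ residueCount m a s + residueCount n (m + a) s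
  residueCount-+ zero    n a s = refl
  residueCount-+ (suc m) n a s = begin
    ⟦ a mod k ≟ s ⟧ + ∑[ v < m + n ] ⟦ (suc (toℕ v) + a) mod k ≟ s ⟧
      ≡⟨ cong (⟦ a mod k ≟ s ⟧ +_) (shifted (m + n)) ⟩
    ⟦ a mod k ≟ s ⟧ + residueCount (m + n) (suc a) s
      ≡⟨ cong (⟦ a mod k ≟ s ⟧ +_) (residueCount-+ m n (suc a) s) ⟩
    ⟦ a mod k ≟ s ⟧ + (residueCount m (suc a) s + residueCount n (m + suc a) s)
      ≡⟨ sym (+-assoc ⟦ a mod k ≟ s ⟧ _ _) ⟩
    ⟦ a mod k ≟ s ⟧ + residueCount m (suc a) s + residueCount n (m + suc a) s
      ≡⟨ cong₂ (λ x y → ⟦ a mod k ≟ s ⟧ + x + residueCount n y s) (sym (shifted m)) (+-suc m a) ⟩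
    residueCount (suc m) a s + residueCount n (suc m + a) s ∎
    where
    open ≡-Reasoning
    shifted : ∀ l → ∑[ v < l ] ⟦ (suc (toℕ v) + a) mod k ≟ s ⟧ ≡ residueCount l (suc a) s
    shifted l = sum-cong-≗ λ (v : Fin l) → cong (λ x → ⟦ x mod k ≟ s ⟧) (sym (+-suc (toℕ v) a))

  residueCount-suc : ∀ n a s →
    residueCount (suc n) a s ≡ residueCount n a s + ⟦ (n + a) mod k ≟ s ⟧
  residueCount-suc n a s = begin
    residueCount (suc n) a s                           ≡⟨ cong (λ x → residueCount x a s) (+-comm 1 n) ⟩
    residueCount (n + 1) a s                           ≡⟨ residueCount-+ n 1 a s ⟩
    residueCount n a s + residueCount 1 (n + a) s      ≡⟨ cong (residueCount n a s +_) (+-identityʳ _) ⟩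
    residueCount n a s + ⟦ (n + a) mod k ≟ s ⟧         ∎
    where open ≡-Reasoning

  -- Moving the interval one step to the right drops `a` and gains `k + a`, which has the same
  -- residue.
  residueCount-period : ∀ a s → residueCount k a s ≡ 1
  residueCount-period zero s = trans
    (sum-single _ s λ v v≢s → ⟦⟧-no ((toℕ v + 0) mod k ≟ s) (v≢s ∘ trans (sym (v+0-mod v))))
    (⟦⟧-yes ((toℕ s + 0) mod k ≟ s) (v+0-mod s))
    where
    v+0-mod : ∀ v → (toℕ v + 0) mod k ≡ v
    v+0-mod v = trans (cong (_mod k) (+-identityʳ (toℕ v))) (toℕ[i]-mod v)
  residueCount-period (suc a) s = +-cancelˡ-≡ ⟦ a mod k ≟ s ⟧ _ _ (begin
    ⟦ a mod k ≟ s ⟧ + residueCount k (suc a) s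
      ≡⟨ cong (_+ residueCount k (suc a) s) (sym (+-identityʳ ⟦ a mod k ≟ s ⟧)) ⟩
    residueCount 1 a s + residueCount k (1 + a) s
      ≡⟨ sym (residueCount-+ 1 k a s) ⟩
    residueCount (suc k) a s
      ≡⟨ residueCount-suc k a s ⟩
    residueCount k a s + ⟦ (k + a) mod k ≟ s ⟧
      ≡⟨ cong₂ (λ x y → x + ⟦ y ≟ s ⟧) (residueCount-period a s)
           (mod-cong (trans (cong (_% k) (+-comm k a)) ([m+n]%n≡m%n a k))) ⟩
    1 + ⟦ a mod k ≟ s ⟧
      ≡⟨ +-comm 1 ⟦ a mod k ≟ s ⟧ ⟩
    ⟦ a mod k ≟ s ⟧ + 1 ∎)
    where open ≡-Reasoning

  residueCount-* : ∀ q a s → residueCount (q * k) a s ≡ q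
  residueCount-* zero    a s = refl
  residueCount-* (suc q) a s = trans (residueCount-+ k (q * k) a s)
    (cong₂ _+_ (residueCount-period a s) (residueCount-* q (k + a) s))

-- The base colouring and the demands at vertex zero

module Construction (k t N : ℕ) .{{_ : NonZero k}}
                    (3≤k : 3 ≤ k) (1≤t : 1 ≤ t) (1+N≡2kt : suc N ≡ 2 * k * t) where
  open Residues k

  6t≤1+N : 6 * t ≤ suc N
  6t≤1+N = ≤-trans (*-monoˡ-≤ t (*-monoʳ-≤ 2 3≤k)) (≤-reflexive (sym 1+N≡2kt))

  2≤N : 2 ≤ N
  2≤N = ≤-pred (≤-trans (≤-trans (s≤s (s≤s (s≤s z≤n))) (*-monoʳ-≤ 6 1≤t)) 6t≤1+N)

  -- One more integer completes the interval to `2 * t` full periods.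
  residueCount-1+N : ∀ a s → residueCount N a s + ⟦ (N + a) mod k ≟ s ⟧ ≡ 2 * t
  residueCount-1+N a s = begin
    residueCount N a s + ⟦ (N + a) mod k ≟ s ⟧  ≡⟨ sym (residueCount-suc N a s) ⟩
    residueCount (suc N) a s                    ≡⟨ cong (λ x → residueCount x a s) (trans 1+N≡2kt (swap k t)) ⟩
    residueCount (2 * t * k) a s                ≡⟨ residueCount-* (2 * t) a s ⟩
    2 * t                                       ∎
    where
    open ≡-Reasoning
    swap : ∀ k t → 2 * k * t ≡ 2 * t * k
    swap = solve-∀

  residueCount-N≤ : ∀ a s → residueCount N a s ≤ 2 * t
  residueCount-N≤ a s = ≤-trans (m≤m+n _ _) (≤-reflexive (residueCount-1+N a s))

  base : EdgeColouring k N
  base e = (toℕ (low e) + toℕ (high e)) mod k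

  -- Besides the colour class sizes, the two corrections in their double count: the diagonal pairs,
  -- and the one integer that completes the row of each `u` to full periods.
  baseCount loops missing : Fin k → ℕ
  baseCount s = ∑ₑ (λ e → ⟦ base e ≟ s ⟧)
  loops     s = ∑[ u < N ] ⟦ (toℕ u + toℕ u) mod k ≟ s ⟧
  missing   s = ∑[ u < N ] ⟦ (N + toℕ u) mod k ≟ s ⟧

  -- For each u, the numbers u, ..., u + N cover every residue 2t times.
  baseCount-double : ∀ s → 2 * baseCount s + loops s + missing s ≡ 2 * (t * N)
  baseCount-double s = begin
    2 * baseCount s + loops s + missing s
      ≡⟨ cong (_+ missing s) (sym (∑-symmetric f f-sym)) ⟩
    ∑[ u < N ] ∑[ v < N ] f u v + missing s
      ≡⟨ cong (_+ missing s) (sum-cong-≗ λ u → sum-cong-≗ λ v → f-sym u v) ⟩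
    ∑[ u < N ] residueCount N (toℕ u) s + missing s
      ≡⟨ sym (∑-distrib-+ (λ (u : Fin N) → residueCount N (toℕ u) s) _) ⟩
    ∑[ u < N ] (residueCount N (toℕ u) s + ⟦ (N + toℕ u) mod k ≟ s ⟧)
      ≡⟨ sum-cong-≗ (λ (u : Fin N) → residueCount-1+N (toℕ u) s) ⟩
    ∑[ u < N ] (2 * t)
      ≡⟨ sum-const N (2 * t) ⟩
    N * (2 * t)
      ≡⟨ swap N t ⟩
    2 * (t * N) ∎
    where
    open ≡-Reasoning
    f : Fin N → Fin N → ℕ
    f u v = ⟦ (toℕ u + toℕ v) mod k ≟ s ⟧
    f-sym : ∀ u v → f u v ≡ f v u
    f-sym u v = cong (λ x → ⟦ x mod k ≟ s ⟧) (+-comm (toℕ u) (toℕ v))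
    swap : ∀ n t → n * (2 * t) ≡ 2 * (t * n)
    swap = solve-∀

  -- A balanced colouring has `t * N` edges of each colour, since the complete graph on `suc N`
  -- vertices has `k * (t * N)` edges. The edges at vertex zero must supply the difference;
  -- `demand+baseCount` shows that the subtraction is not truncated.
  demand : Fin k → ℕ
  demand s = t * N ∸ baseCount s

  demand+baseCount : ∀ s → demand s + baseCount s ≡ t * N
  demand+baseCount s = m∸n+n≡m {t * N} {baseCount s} (*-cancelˡ-≤ 2 (begin
    2 * baseCount s                          ≤⟨ m≤m+n _ (loops s) ⟩
    2 * baseCount s + loops s                ≤⟨ m≤m+n _ (missing s) ⟩
    2 * baseCount s + loops s + missing s    ≡⟨ baseCount-double s ⟩
    2 * (t * N)                              ∎))
    where open ≤-Reasoning

  demand-double : ∀ s → 2 * demand s ≡ loops s + missing s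
  demand-double s = +-cancelˡ-≡ (2 * baseCount s) _ _ (begin
    2 * baseCount s + 2 * demand s             ≡⟨ regroup (baseCount s) (demand s) ⟩
    2 * (demand s + baseCount s)               ≡⟨ cong (2 *_) (demand+baseCount s) ⟩
    2 * (t * N)                                ≡⟨ sym (baseCount-double s) ⟩
    2 * baseCount s + loops s + missing s      ≡⟨ +-assoc (2 * baseCount s) _ _ ⟩
    2 * baseCount s + (loops s + missing s)    ∎)
    where
    open ≡-Reasoning
    regroup : ∀ c d → 2 * c + 2 * d ≡ 2 * (d + c)
    regroup = solve-∀

  -- Of the `k * (t * N)` edges, those avoiding zero are removed. Doubling and adding `N * N`, in
  -- the form given by `square`, avoids division and subtraction.
  sum-demand : sum demand ≡ N
  sum-demand = *-cancelˡ-≡ _ _ 2 (+-cancelʳ-≡ (2 * ∑ₑ {N} (λ _ → 1) + N) _ _ (begin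
    2 * sum demand + (2 * ∑ₑ {N} (λ _ → 1) + N)
      ≡⟨ regroup (sum demand) (∑ₑ {N} (λ _ → 1)) N ⟩
    2 * (sum demand + ∑ₑ {N} (λ _ → 1)) + N
      ≡⟨ cong (λ x → 2 * x + N) total ⟩
    2 * (k * (t * N)) + N
      ≡⟨ regroup′ k t N ⟩
    2 * k * t * N + N
      ≡⟨ cong (λ x → x * N + N) (sym 1+N≡2kt) ⟩
    suc N * N + N
      ≡⟨ regroup″ N ⟩
    2 * N + N * N
      ≡⟨ cong (2 * N +_) square ⟩
    2 * N + (2 * ∑ₑ {N} (λ _ → 1) + N) ∎))
    where
    open ≡-Reasoning
    regroup : ∀ d e n → 2 * d + (2 * e + n) ≡ 2 * (d + e) + n
    regroup = solve-∀
    regroup′ : ∀ k t n → 2 * (k * (t * n)) + n ≡ 2 * k * t * n + n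
    regroup′ = solve-∀
    regroup″ : ∀ n → suc n * n + n ≡ 2 * n + n * n
    regroup″ = solve-∀

    square : N * N ≡ 2 * ∑ₑ {N} (λ _ → 1) + N
    square = begin
      N * N                          ≡⟨ cong (N *_) (sym N≡) ⟩
      N * (∑[ v < N ] 1)             ≡⟨ sym (sum-const N _) ⟩
      ∑[ u < N ] ∑[ v < N ] 1        ≡⟨ ∑-symmetric {N} (λ _ _ → 1) (λ _ _ → refl) ⟩
      2 * ∑ₑ {N} (λ _ → 1) + ∑[ u < N ] 1  ≡⟨ cong (2 * ∑ₑ {N} (λ _ → 1) +_) N≡ ⟩
      2 * ∑ₑ {N} (λ _ → 1) + N       ∎
      where
      N≡ : ∑[ v < N ] 1 ≡ N
      N≡ = trans (sum-const N 1) (*-identityʳ N)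

    sum-baseCount : sum baseCount ≡ ∑ₑ {N} (λ _ → 1)
    sum-baseCount = trans
      (sum-cong-≗ λ s → sym (trans (*-identityˡ _) (∑ₑ-cong {N} λ e → *-identityˡ ⟦ base e ≟ s ⟧)))
      (∑ₑ-weights {k} {N} (λ _ → 1) (λ _ → 1) base)

    total : sum demand + ∑ₑ {N} (λ _ → 1) ≡ k * (t * N)
    total = begin
      sum demand + ∑ₑ {N} (λ _ → 1)           ≡⟨ cong (sum demand +_) (sym sum-baseCount) ⟩
      sum demand + sum baseCount              ≡⟨ sym (∑-distrib-+ demand baseCount) ⟩
      ∑[ s < k ] (demand s + baseCount s)     ≡⟨ sum-cong-≗ demand+baseCount ⟩
      ∑[ s < k ] (t * N)                      ≡⟨ sum-const k (t * N) ⟩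
      k * (t * N)                             ∎

  -- Since k does not divide 2, one of the vertices 0 and 1 does not count.
  loops<N : ∀ s → loops s < N
  loops<N s = bound N 2≤N
    where
    h : ℕ → ℕ
    h u = ⟦ (u + u) mod k ≟ s ⟧

    h0+h1≤1 : h 0 + h 1 ≤ 1
    h0+h1≤1 with 0 mod k ≟ s
    ... | no _   = ⟦⟧≤1 (2 mod k ≟ s)
    ... | yes p with 2 mod k ≟ s
    ...   | no _  = s≤s z≤n
    ...   | yes q = contradiction (begin
        0              ≡⟨ sym (m<n⇒m%n≡m (≤-trans (s≤s z≤n) 3≤k)) ⟩
        0 % k          ≡⟨ sym (toℕ-mod 0) ⟩
        toℕ (0 mod k)  ≡⟨ cong toℕ (trans p (sym q)) ⟩
        toℕ (2 mod k)  ≡⟨ toℕ-mod 2 ⟩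
        2 % k          ≡⟨ m<n⇒m%n≡m 3≤k ⟩
        2              ∎) λ ()
        where open ≡-Reasoning

    bound : ∀ n → 2 ≤ n → ∑[ u < n ] h (toℕ u) < n
    bound (suc (suc n)) _ = s≤s (begin
      h 0 + (h 1 + ∑[ u < n ] h (toℕ (suc (suc u))))
        ≡⟨ sym (+-assoc (h 0) _ _) ⟩
      h 0 + h 1 + ∑[ u < n ] h (toℕ (suc (suc u)))
        ≤⟨ +-mono-≤ h0+h1≤1 (sum-mono {n} λ u → ⟦⟧≤1 ((2 + toℕ u + (2 + toℕ u)) mod k ≟ s)) ⟩
      1 + ∑[ u < n ] 1
        ≡⟨ cong suc (trans (sum-const n 1) (*-identityʳ n)) ⟩
      suc n ∎)
      where open ≤-Reasoning
    bound (suc zero) (s≤s ())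

  missing≤2t : ∀ s → missing s ≤ 2 * t
  missing≤2t s = subst (_≤ 2 * t)
    (sum-cong-≗ λ (u : Fin N) → cong (λ x → ⟦ x mod k ≟ s ⟧) (+-comm (toℕ u) N))
    (residueCount-N≤ N s)

  -- Twice the left side is at most `(N - 1) + 2t + 4t`. The hypothesis `3 ≤ k` gives `6t ≤ N + 1`,
  -- and the strictness of `loops<N` pays for the extra 1.
  hall : ∀ a s → demand s + residueCount N a s ≤ N
  hall a s = *-cancelˡ-≤ 2 (≤-pred (begin
    suc (2 * (demand s + #a))                ≡⟨ cong suc (*-distribˡ-+ 2 (demand s) #a) ⟩
    suc (2 * demand s + 2 * #a)              ≡⟨ cong (λ x → suc (x + 2 * #a)) (demand-double s) ⟩
    suc (loops s) + missing s + 2 * #a       ≤⟨ +-mono-≤ (+-mono-≤ (loops<N s) (missing≤2t s))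
                                                  (*-monoʳ-≤ 2 (residueCount-N≤ a s)) ⟩
    N + 2 * t + 2 * (2 * t)                  ≡⟨ regroup N t ⟩
    N + 6 * t                                ≤⟨ +-monoʳ-≤ N 6t≤1+N ⟩
    N + suc N                                ≡⟨ regroup′ N ⟩
    suc (2 * N)                              ∎))
    where
    open ≤-Reasoning
    #a = residueCount N a s
    regroup : ∀ n t → n + 2 * t + 2 * (2 * t) ≡ n + 6 * t
    regroup = solve-∀
    regroup′ : ∀ n → n + suc n ≡ suc (2 * n)
    regroup′ = solve-∀

  -- The colouring of the whole graph

  labelSum colourSum offset : ℕ
  labelSum  = ∑[ j < N ] toℕ j
  colourSum = ∑[ c < k ] (toℕ c * t)
  -- Congruent to colourSum − labelSum modulo k.
  offset    = colourSum + pred k * labelSum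

  -- If zero is matched with `j` by an edge of colour `c`, the other matching edges have label sum
  -- `labelSum - j`, so balance forces `c + labelSum - j` to be congruent to `colourSum`.
  forbidden : Fin N → Fin k
  forbidden j = (toℕ j + offset) mod k

  star : Avoiding forbidden demand
  -- `count forbidden` unfolds to `residueCount N offset`, so `hall offset` is exactly Hall's
  -- condition.
  star = avoiding forbidden demand sum-demand (hall offset)

  α : Fin N → Fin k
  α = proj₁ star

  colouring : EdgeColouring k (suc N)
  colouring (edge zero    (suc j) _) = α j
  colouring (edge (suc i) (suc j) _) = (toℕ i + toℕ j) mod k

  colouring-balanced : ColourBalanced colouring
  colouring-balanced c d = trans (size c) (sym (size d))
    where
    size : ∀ c → colourCount colouring c (edges (suc N)) ≡ t * N
    size c = trans (colourCount-edges colouring c)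
      -- The edge sum reduces to the count of `α` at vertex zero plus `baseCount c`, as `colouring`
      -- agrees with `base` on shifted edges.
      (trans (cong (_+ baseCount c) (proj₂ (proj₂ star) c)) (demand+baseCount c))

  -- Consequences of a balanced perfect matching

  module _ (M : EdgeSet (suc N)) (perfect : PerfectMatching M)
           (balanced : EquallyColoured colouring (members M)) where
    m : Edge (suc N) → ℕ
    m e = ⟦ T? (M e) ⟧

    usage : Fin k → ℕ
    usage c = ∑ₑ (λ e → m e * ⟦ colouring e ≟ c ⟧)

    -- The `k` equal usages add up to the size of `M`, and twice that size is the number of vertices
    -- by `handshake`.
    usage≡t : ∀ c → usage c ≡ t
    usage≡t c = *-cancelˡ-≡ _ _ (2 * k) {{m*n≢0 2 k}} (begin
      2 * k * usage c
        ≡⟨ *-assoc 2 k (usage c) ⟩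
      2 * (k * usage c)
        ≡⟨ cong (2 *_) (sym (sum-const k (usage c))) ⟩
      2 * (∑[ d < k ] usage c)
        ≡⟨ cong (2 *_) (sum-cong-≗ λ d → trans (usage-equal c d) (sym (*-identityˡ (usage d)))) ⟩
      2 * (∑[ d < k ] (1 * usage d))
        ≡⟨ cong (2 *_) (∑ₑ-weights (λ _ → 1) m colouring) ⟩
      2 * ∑ₑ (λ e → m e * 1)
        ≡⟨ *-distribˡ-∑ₑ 2 (λ e → m e * 1) ⟩
      ∑ₑ (λ e → 2 * (m e * 1))
        ≡⟨ ∑ₑ-cong (λ e → regroup (m e)) ⟩
      ∑ₑ (λ e → m e * (1 + 1))
        ≡⟨ handshake perfect (λ _ → 1) ⟩
      ∑[ v < suc N ] 1
        ≡⟨ trans (sum-const (suc N) 1) (*-identityʳ (suc N)) ⟩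
      suc N
        ≡⟨ 1+N≡2kt ⟩
      2 * k * t ∎)
      where
      open ≡-Reasoning
      regroup : ∀ x → 2 * (x * 1) ≡ x * 2
      regroup = solve-∀
      usage-equal : ∀ c d → usage c ≡ usage d
      usage-equal c d = trans (sym (colourCount-members colouring M c))
        (trans (balanced c d) (colourCount-members colouring M d))

    zero-edge : Σ[ j ∈ Fin N ] T (M (edge₀ j)) × (∀ i → i ≢ j → ¬ T (M (edge₀ i)))
    zero-edge with perfect zero
    ... | edge zero (suc j) (s≤s z≤n) , (e∈M , _) , unique =
      j , e∈M , λ i i≢j i∈M → i≢j (suc-injective (cong high (sym (unique (i∈M , inj₁ refl)))))
    ... | edge (suc i) (suc j) _ , (_ , inj₁ ()) , _
    ... | edge (suc i) (suc j) _ , (_ , inj₂ ()) , _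

    j₀ : Fin N
    j₀ = proj₁ zero-edge

    sum-at-zero : (w : Fin N → ℕ) → ∑[ j < N ] (m (edge₀ j) * w j) ≡ w j₀
    sum-at-zero w = trans
      (sum-single _ j₀ λ i i≢j₀ →
        cong (_* w i) (⟦⟧-no (T? (M (edge₀ i))) (proj₂ (proj₂ zero-edge) i i≢j₀)))
      (trans (cong (_* w j₀) (⟦⟧-yes (T? (M (edge₀ j₀))) (proj₁ (proj₂ zero-edge))))
        (*-identityˡ (w j₀)))

    -- Vertex zero weighs nothing, so the matching edge at zero contributes just `toℕ j₀`.
    label : Fin (suc N) → ℕ
    label zero    = 0
    label (suc j) = toℕ j

    restColours restLabels : ℕ
    restColours = ∑ₑ (λ e → m (shift e) * toℕ (base e))
    restLabels  = ∑ₑ (λ e → m (shift e) * (toℕ (low e) + toℕ (high e)))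

    rest-congruent : restColours % k ≡ restLabels % k
    rest-congruent = ∑ₑ-cong-% λ e → *-cong-% (does (T? (M (shift e)))) e
      where
      *-cong-% : ∀ b e → ((if b then 1 else 0) * toℕ (base e)) % k ≡
                         ((if b then 1 else 0) * (toℕ (low e) + toℕ (high e))) % k
      *-cong-% false e = refl
      *-cong-% true  e = +-cong-% (trans (cong (_% k) (toℕ-mod x)) (m%n%n≡m%n x k)) refl
        where x = toℕ (low e) + toℕ (high e)

    colours-total : toℕ (α j₀) + restColours ≡ colourSum
    colours-total = begin
      toℕ (α j₀) + restColours
        ≡⟨ cong (_+ restColours) (sym (sum-at-zero (toℕ ∘ α))) ⟩
      ∑ₑ (λ e → m e * toℕ (colouring e))
        ≡⟨ sym (∑ₑ-weights toℕ m colouring) ⟩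
      ∑[ c < k ] (toℕ c * usage c)
        ≡⟨ sum-cong-≗ (λ (c : Fin k) → cong (toℕ c *_) (usage≡t c)) ⟩
      colourSum ∎
      where open ≡-Reasoning

    labels-total : toℕ j₀ + restLabels ≡ labelSum
    labels-total = trans (cong (_+ restLabels) (sym (sum-at-zero toℕ))) (handshake perfect label)

    -- The colours and the labels of `M` have known totals, and away from zero their sums agree
    -- modulo `k`. Eliminating these sums leaves the colour at `j₀`.
    α-forbidden : α j₀ ≡ forbidden j₀
    α-forbidden = trans (sym (toℕ[i]-mod (α j₀))) (mod-cong (begin
      a % k
        -- A multiple of `k` is added and split as `labelSum + pred k * labelSum`; the second
        -- summand stands in for subtracting `labelSum`.
        ≡⟨ sym ([m+kn]%n≡m%n a labelSum k) ⟩
      (a + labelSum * k) % k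
        ≡⟨ cong (λ x → (a + x) % k) (trans (*-comm labelSum k) (cong (_* labelSum) (sym (suc-pred k)))) ⟩
      (a + (labelSum + pred k * labelSum)) % k
        ≡⟨ cong (λ x → (a + (x + pred k * labelSum)) % k) (sym labels-total) ⟩
      (a + (toℕ j₀ + restLabels + pred k * labelSum)) % k
        ≡⟨ cong (_% k) (regroup a (toℕ j₀) restLabels (pred k * labelSum)) ⟩
      (toℕ j₀ + a + pred k * labelSum + restLabels) % k
        ≡⟨ +-cong-% {toℕ j₀ + a + pred k * labelSum} refl (sym rest-congruent) ⟩
      (toℕ j₀ + a + pred k * labelSum + restColours) % k
        ≡⟨ cong (_% k) (regroup′ (toℕ j₀) a (pred k * labelSum) restColours) ⟩
      (toℕ j₀ + (a + restColours + pred k * labelSum)) % k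
        ≡⟨ cong (λ x → (toℕ j₀ + (x + pred k * labelSum)) % k) colours-total ⟩
      (toℕ j₀ + offset) % k ∎))
      where
      open ≡-Reasoning
      a = toℕ (α j₀)
      regroup : ∀ a j r p → a + (j + r + p) ≡ j + a + p + r
      regroup = solve-∀
      regroup′ : ∀ j a p r → j + a + p + r ≡ j + (a + r + p)
      regroup′ = solve-∀

  no-balanced-matching : ¬ ∃ λ M → ColourBalancedMatching colouring M
  no-balanced-matching (M , perfect , balanced) =
    proj₁ (proj₂ star) (j₀ M perfect balanced) (α-forbidden M perfect balanced)

theorem5p3 : ∀ (k t : ℕ) → 3 ≤ k → 1 ≤ t →
    Σ[ χ ∈ EdgeColouring k (2 * k * t) ]
    (ColourBalanced χ × ¬ (∃ λ M → ColourBalancedMatching χ M))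
theorem5p3 k@(suc _) t@(suc _) 3≤k 1≤t =
  colouring , colouring-balanced , no-balanced-matching
  -- As `k` and `t` are successors, `2 * k * t` reduces to a successor, so `refl` proves the
  -- equation for `N`.
  where open Construction k t (pred (2 * k * t)) 3≤k 1≤t refl
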